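{- The bite at $(2,2)$ is a winning opening move of the $a\times b$ bar if and only if $a=b$. Consequently the number of winning opening moves of a square bar is odd; in particular no square bar has exactly two.
   Context: Chomp on the $a\times b$ bar: the board consists of the cells $(r,c)$ with $1\le r\le a$, $1\le c\le b$ (rows indexed downward). Two players alternate. A move (bite) at a remaining cell $(i,j)$ removes every remaining cell $(r,c)$ with $r\ge i$ and $c\ge j$. The player forced to take the poisoned cell $(1,1)$ loses. A position is a $P$-position if the player to move loses under optimal play. An opening move (a bite of the full bar) is winning if it leaves a $P$-position for the opponent. A square bar is one with $a=b$.
   Formalization: The 1×1 bar is excluded from the equivalence and from the oddness claim, because there (2,2) is not a cell and the only move takes the poison, so there are 0 winning openings; the claim "never exactly two" still covers every square bar. -}

module Defs where

open import Data.Nat using (ℕ; suc; _≤_; _<_; _≤?_; _≟_; s≤s)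
open import Data.Nat.Properties using (≤-refl; ≤-trans)
open import Data.List using (List; []; _∷_; length; map; filter; upTo; cartesianProduct)
open import Data.List.Properties using (filter-notAll)
open import Data.List.Membership.Propositional using (_∈_; _∉_; lose)
open import Data.List.Relation.Unary.Any using (here; there)
open import Data.Product using (_×_; _,_; ∃)
open import Data.Product.Properties using (≡-dec)
open import Data.Sum using (_⊎_; inj₁; inj₂)
open import Function using (_∘_)
open import Relation.Nullary using (¬_; yes; no)
open import Relation.Nullary.Decidable using (¬?; _×-dec_)
open import Relation.Unary using (Decidable)
open import Relation.Binary using (DecidableEquality)
open import Relation.Binary.PropositionalEquality using (_≡_; refl)

-- (row , column), both counted from 1.
Cell : Set
Cell = ℕ × ℕ

_≟ᶜ_ : DecidableEquality Cell
_≟ᶜ_ = ≡-dec _≟_ _≟_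

open import Data.List.Membership.DecPropositional _≟ᶜ_ using (_∈?_)

-- The remaining cells, listed without repetition in every position that
-- arises from a bar.
Position : Set
Position = List Cell

bar : ℕ → ℕ → Position
bar a b = cartesianProduct (map suc (upTo a)) (map suc (upTo b))

Removes : Cell → Cell → Set
Removes (i , j) (r , c) = i ≤ r × j ≤ c

removes? : ∀ x → Decidable (Removes x)
removes? (i , j) (r , c) = (i ≤? r) ×-dec (j ≤? c)

bite : Cell → Position → Position
bite x p = filter (λ y → ¬? (removes? x y)) p

poison : Cell
poison = 1 , 1

-- Optimal play.  Taking the poison is a legal move, but it loses: once the
-- poison is gone, the player now to move has won.  Both predicates are
-- inductive, so a proof of either is a winning strategy tree (for the player
-- to move, respectively for the opponent).
data NPosition (p : Position) : Set
data PPosition (p : Position) : Set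

data NPosition p where
  poisonTaken : poison ∉ p → NPosition p
  move        : ∀ x → x ∈ p → PPosition (bite x p) → NPosition p

data PPosition p where
  allLose : poison ∈ p → (∀ x → x ∈ p → NPosition (bite x p)) → PPosition p

N⇒¬P : ∀ {p} → NPosition p → ¬ PPosition p
N⇒¬P (poisonTaken ∉p) (allLose ∈p _)  = ∉p ∈p
N⇒¬P (move x x∈p P)   (allLose _ all) = N⇒¬P (all x x∈p) P

bite-shrinks : ∀ x p → x ∈ p → length (bite x p) < length p
bite-shrinks x p x∈p =
  filter-notAll (λ y → ¬? (removes? x y)) p
    (lose x∈p (λ ¬r → ¬r (≤-refl , ≤-refl)))

some-or-all : ∀ {Q R : Cell → Set} p → (∀ x → x ∈ p → Q x ⊎ R x) →
              (∃ λ x → x ∈ p × Q x) ⊎ (∀ x → x ∈ p → R x)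
some-or-all []      f = inj₂ λ _ ()
some-or-all (y ∷ p) f with f y (here refl) | some-or-all p (λ x → f x ∘ there)
... | inj₁ q | _                  = inj₁ (y , here refl , q)
... | inj₂ _ | inj₁ (x , x∈p , q) = inj₁ (x , there x∈p , q)
... | inj₂ r | inj₂ rs            = inj₂ λ where
  _ (here refl) → r
  x (there x∈p) → rs x x∈p

P-or-N : ∀ p → PPosition p ⊎ NPosition p
P-or-N p = go (suc (length p)) p ≤-refl
  where
  go : ∀ n p → length p < n → PPosition p ⊎ NPosition p
  go (suc n) p (s≤s p≤n) with poison ∈? p
  ... | no  ∉p = inj₂ (poisonTaken ∉p)
  ... | yes ∈p with some-or-all p
                      (λ x x∈p → go n (bite x p) (≤-trans (bite-shrinks x p x∈p) p≤n))
  ...   | inj₁ (x , x∈p , P) = inj₂ (move x x∈p P)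
  ...   | inj₂ Ns            = inj₁ (allLose ∈p Ns)

PPosition? : Decidable PPosition
PPosition? p with P-or-N p
... | inj₁ P = yes P
... | inj₂ N = no (N⇒¬P N)

-- The cell must lie on the bar: a bite elsewhere is not a move.
WinningOpening : ℕ → ℕ → Cell → Set
WinningOpening a b x = x ∈ bar a b × PPosition (bite x (bar a b))

WinningOpening? : ∀ a b → Decidable (WinningOpening a b)
WinningOpening? a b x = (x ∈? bar a b) ×-dec PPosition? (bite x (bar a b))

-- Distinct cells are distinct moves, and bar a b lists each cell once.
#winningOpenings : ℕ → ℕ → ℕ
#winningOpenings a b = length (filter (WinningOpening? a b) (bar a b))

{-# OPTIONS --safe #-}
module Submission where

-- Biting (2 , 2) leaves an ell: the first column, of length a, and the first
-- row, of length b, sharing the poisoned corner.  An ell is a game of two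
-- heaps with a forbidden corner.  If its arms are equal, the opponent answers
-- every shortening of one arm by the same shortening of the other, so it is a
-- P-position (`equal-arms-P`); if they are unequal, the player to move
-- equalises them, so it is an N-position (`shorter-column-N`,
-- `shorter-row-N`).  Hence (2 , 2) wins exactly on square bars.
--
-- For the parity, transposing the square bar permutes its winning openings
-- (`winning-swap`), so their number has the parity of the number of winning
-- openings on the diagonal (`count-square`).  There (1 , 1) takes the poison,
-- (2 , 2) wins, and any later (i , i) loses to the reply (2 , 2), which leaves
-- the ell with equal arms again.  So (2 , 2) is the only one, and the number
-- is odd.

open import Data.Nat using (ℕ; zero; suc; _+_; _*_; _≤_; _<_; _%_; z≤n; s≤s)
open import Data.Nat.Properties
  using (≤-refl; <⇒≤; <-≤-trans; <⇒≱; ≰⇒>; <-cmp)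
open import Data.Nat.DivMod using ([m+kn]%n≡m%n)
open import Data.Nat.Induction using (Acc; acc; <-wellFounded)
open import Data.Nat.Tactic.RingSolver using (solve-∀)
open import Data.List using (List; []; _∷_; _++_; length; map; filter; upTo; applyUpTo; cartesianProduct)
open import Data.List.Properties
  using (length-++; filter-++; filter-accept; filter-reject; filter-none; map-applyUpTo)
open import Data.List.Membership.Propositional using (_∈_)
open import Data.List.Membership.Propositional.Properties
  using (∈-filter⁺; ∈-filter⁻; ∈-map⁺; ∈-map⁻; ∈-upTo⁺; ∈-upTo⁻;
         ∈-cartesianProduct⁺; ∈-cartesianProduct⁻)
open import Data.List.Relation.Unary.All.Properties using (applyUpTo⁺₂)
open import Data.Product using (_×_; _,_; proj₁; proj₂; swap; ∃)
open import Function using (_∘_; case_of_)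
open import Function.Bundles using (_⇔_; mk⇔; module Equivalence)
open import Relation.Nullary using (¬_; yes; no; contradiction)
open import Relation.Nullary.Decidable using (¬?)
open import Relation.Unary using (Pred; Decidable)
open import Relation.Binary using (tri<; tri≈; tri>)
open import Relation.Binary.PropositionalEquality
  using (_≡_; _≢_; refl; sym; trans; cong; cong₂; module ≡-Reasoning)
open import Level using (0ℓ)
open import Defs

open Equivalence using (to; from)

-- Cells of bars and of bitten positions

∈-bite⁺ : ∀ {x y p} → y ∈ p → ¬ Removes x y → y ∈ bite x p
∈-bite⁺ {x} = ∈-filter⁺ (λ y → ¬? (removes? x y))

∈-bite⁻ : ∀ {x y p} → y ∈ bite x p → y ∈ p × ¬ Removes x y
∈-bite⁻ {x} = ∈-filter⁻ (λ y → ¬? (removes? x y))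

-- Biting the poison removes it, so such a bite always loses.
poison-bite-N : ∀ p → NPosition (bite poison p)
poison-bite-N p = poisonTaken λ ∈b → proj₂ (∈-bite⁻ {p = p} ∈b) (≤-refl , ≤-refl)

-- The cells of the a × b bar, with coordinates shifted down to 0-based bounds.
data OnBar (a b : ℕ) : Cell → Set where
  on : ∀ {r c} → r < a → c < b → OnBar a b (suc r , suc c)

∈-bar⁺ : ∀ {a b y} → OnBar a b y → y ∈ bar a b
∈-bar⁺ (on r<a c<b) =
  ∈-cartesianProduct⁺ (∈-map⁺ suc (∈-upTo⁺ r<a)) (∈-map⁺ suc (∈-upTo⁺ c<b))

∈-bar⁻ : ∀ {a b y} → y ∈ bar a b → OnBar a b y
∈-bar⁻ {a} {b} y∈ with ∈-cartesianProduct⁻ (map suc (upTo a)) (map suc (upTo b)) y∈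
... | r∈ , c∈ with ∈-map⁻ suc r∈ | ∈-map⁻ suc c∈
...   | _ , r∈′ , refl | _ , c∈′ , refl = on (∈-upTo⁻ r∈′) (∈-upTo⁻ c∈′)

-- Transposition

-- q consists of the transposed cells of p; multiplicity and order are ignored.
Transposed : Position → Position → Set
Transposed p q = ∀ y → y ∈ p ⇔ swap y ∈ q

bite-transposed : ∀ {p q} x → Transposed p q → Transposed (bite x p) (bite (swap x) q)
bite-transposed {p} {q} x t y = mk⇔
  (λ y∈ → let y∈p , ¬r = ∈-bite⁻ {p = p} y∈ in ∈-bite⁺ (to (t y) y∈p) (¬r ∘ swap))
  (λ y∈ → let y∈q , ¬r = ∈-bite⁻ {p = q} y∈ in ∈-bite⁺ (from (t y) y∈q) (¬r ∘ swap))

P-transposed : ∀ {p q} → Transposed p q → PPosition p → PPosition q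
N-transposed : ∀ {p q} → Transposed p q → NPosition p → NPosition q

P-transposed t (allLose ∈p all) = allLose (to (t poison) ∈p) λ x x∈q →
  N-transposed (bite-transposed (swap x) t) (all (swap x) (from (t (swap x)) x∈q))

N-transposed t (poisonTaken ∉p)  = poisonTaken (∉p ∘ from (t poison))
N-transposed t (move x x∈p P) =
  move (swap x) (to (t x) x∈p) (P-transposed (bite-transposed x t) P)

bar-transposed : ∀ a b → Transposed (bar a b) (bar b a)
bar-transposed a b y = mk⇔ (∈-bar⁺ ∘ transpose {a} {b} ∘ ∈-bar⁻) (∈-bar⁺ ∘ transpose {b} {a} ∘ ∈-bar⁻)
  where
  transpose : ∀ {a b y} → OnBar a b y → OnBar b a (swap y)
  transpose (on r<a c<b) = on c<b r<a

winning-swap : ∀ a b x → WinningOpening a b x → WinningOpening b a (swap x)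
winning-swap a b x (x∈ , P) =
  to (bar-transposed a b x) x∈ , P-transposed (bite-transposed x (bar-transposed a b)) P

-- Ells

-- The ell with m cells in the first column and n cells in the first row, the
-- corner counted in both; for m and n positive the corner has two proofs.
data Ell (m n : ℕ) : Cell → Set where
  down   : ∀ {r} → r < m → Ell m n (suc r , 1)
  across : ∀ {c} → c < n → Ell m n (1 , suc c)

-- The position p has exactly the cells of the ell.
IsEll : ℕ → ℕ → Position → Set
IsEll m n p = ∀ y → y ∈ p ⇔ Ell m n y

shorten-column : ∀ {k m n p} → 1 ≤ k → k ≤ m →
                 IsEll m n p → IsEll k n (bite (suc k , 1) p)
shorten-column {k} {m} {n} {p} 1≤k k≤m e y = mk⇔ remaining kept
  where
  remaining : ∀ {y} → y ∈ bite (suc k , 1) p → Ell k n y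
  remaining {y} y∈ with ∈-bite⁻ {p = p} y∈
  ... | y∈p , ¬r with to (e y) y∈p
  ...   | down _     = down (≰⇒> λ k≤r → ¬r (s≤s k≤r , ≤-refl))
  ...   | across c<n = across c<n
  kept : ∀ {y} → Ell k n y → y ∈ bite (suc k , 1) p
  kept (down r<k)   = ∈-bite⁺ (from (e _) (down (<-≤-trans r<k k≤m)))
                              (λ { (s≤s k≤r , _) → <⇒≱ r<k k≤r })
  kept (across c<n) = ∈-bite⁺ (from (e _) (across c<n))
                              (λ { (s≤s k≤0 , _) → <⇒≱ 1≤k k≤0 })

shorten-row : ∀ {k m n p} → 1 ≤ k → k ≤ n →
              IsEll m n p → IsEll m k (bite (1 , suc k) p)
shorten-row {k} {m} {n} {p} 1≤k k≤n e y = mk⇔ remaining kept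
  where
  remaining : ∀ {y} → y ∈ bite (1 , suc k) p → Ell m k y
  remaining {y} y∈ with ∈-bite⁻ {p = p} y∈
  ... | y∈p , ¬r with to (e y) y∈p
  ...   | down r<m = down r<m
  ...   | across _ = across (≰⇒> λ k≤c → ¬r (≤-refl , s≤s k≤c))
  kept : ∀ {y} → Ell m k y → y ∈ bite (1 , suc k) p
  kept (down r<m)   = ∈-bite⁺ (from (e _) (down r<m))
                              (λ { (_ , s≤s k≤0) → <⇒≱ 1≤k k≤0 })
  kept (across c<k) = ∈-bite⁺ (from (e _) (across (<-≤-trans c<k k≤n)))
                              (λ { (_ , s≤s k≤c) → <⇒≱ c<k k≤c })

-- The induction is on m.  A bite off the corner leaves its arm with suc k < m
-- cells, and the reply cuts the other arm down to suc k cells as well.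
equal-arms-P′ : ∀ {m p} → Acc _<_ m → 1 ≤ m → IsEll m m p → PPosition p
equal-arms-P′ {m} {p} (acc rs) 1≤m e =
  allLose (from (e poison) (down 1≤m)) (λ x x∈p → reply (to (e x) x∈p))
  where
  reply : ∀ {x} → Ell m m x → NPosition (bite x p)
  reply (down {zero} _)      = poison-bite-N p
  reply (across {zero} _)    = poison-bite-N p
  reply (down {suc k} k<m)   =
    let e′ = shorten-column (s≤s z≤n) (<⇒≤ k<m) e in
    move (1 , suc (suc k)) (from (e′ _) (across k<m))
      (equal-arms-P′ (rs k<m) (s≤s z≤n) (shorten-row (s≤s z≤n) (<⇒≤ k<m) e′))
  reply (across {suc k} k<m) =
    let e′ = shorten-row (s≤s z≤n) (<⇒≤ k<m) e in
    move (suc (suc k) , 1) (from (e′ _) (down k<m))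
      (equal-arms-P′ (rs k<m) (s≤s z≤n) (shorten-column (s≤s z≤n) (<⇒≤ k<m) e′))

equal-arms-P : ∀ {m p} → 1 ≤ m → IsEll m m p → PPosition p
equal-arms-P = equal-arms-P′ (<-wellFounded _)

shorter-column-N : ∀ {m n p} → 1 ≤ m → m < n → IsEll m n p → NPosition p
shorter-column-N {m} 1≤m m<n e =
  move (1 , suc m) (from (e _) (across m<n))
    (equal-arms-P 1≤m (shorten-row 1≤m (<⇒≤ m<n) e))

shorter-row-N : ∀ {m n p} → 1 ≤ n → n < m → IsEll m n p → NPosition p
shorter-row-N {n = n} 1≤n n<m e =
  move (suc n , 1) (from (e _) (down n<m))
    (equal-arms-P 1≤n (shorten-column 1≤n (<⇒≤ n<m) e))

-- The bite at (2 , 2)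

-- It leaves an ell not only on the bar itself but on any part of the bar that
-- still contains the whole first row and column.
bite22-ell : ∀ {a b p} → (∀ {y} → y ∈ p → OnBar a b y) → (∀ {y} → Ell a b y → y ∈ p) →
             IsEll a b (bite (2 , 2) p)
bite22-ell {a} {b} {p} p⊆bar ell⊆p y = mk⇔ remaining kept
  where
  remaining : ∀ {y} → y ∈ bite (2 , 2) p → Ell a b y
  remaining y∈ with ∈-bite⁻ {p = p} y∈
  ... | y∈p , ¬r with p⊆bar y∈p
  ...   | on {zero}          _   c<b = across c<b
  ...   | on {suc r} {zero}  r<a _   = down r<a
  ...   | on {suc r} {suc c} _   _   = contradiction (s≤s (s≤s z≤n) , s≤s (s≤s z≤n)) ¬r
  kept : ∀ {y} → Ell a b y → y ∈ bite (2 , 2) p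
  kept l@(down _)   = ∈-bite⁺ (ell⊆p l) (λ { (_ , s≤s ()) })
  kept l@(across _) = ∈-bite⁺ (ell⊆p l) (λ { (s≤s () , _) })

ell⊆bar : ∀ {a b y} → 1 ≤ a → 1 ≤ b → Ell a b y → y ∈ bar a b
ell⊆bar 1≤a 1≤b (down r<a)   = ∈-bar⁺ (on r<a 1≤b)
ell⊆bar 1≤a 1≤b (across c<b) = ∈-bar⁺ (on 1≤a c<b)

bar-bite22-ell : ∀ {a b} → 1 ≤ a → 1 ≤ b → IsEll a b (bite (2 , 2) (bar a b))
bar-bite22-ell 1≤a 1≤b = bite22-ell ∈-bar⁻ (ell⊆bar 1≤a 1≤b)

22-wins⇒square : ∀ {a b} → 1 ≤ a → 1 ≤ b → WinningOpening a b (2 , 2) → a ≡ b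
22-wins⇒square {a} {b} 1≤a 1≤b (_ , P) with <-cmp a b
... | tri< a<b _ _ = contradiction P (N⇒¬P (shorter-column-N 1≤a a<b (bar-bite22-ell 1≤a 1≤b)))
... | tri≈ _ a≡b _ = a≡b
... | tri> _ _ b<a = contradiction P (N⇒¬P (shorter-row-N 1≤b b<a (bar-bite22-ell 1≤a 1≤b)))

22-wins-square : ∀ {n} → 2 ≤ n → WinningOpening n n (2 , 2)
22-wins-square 2≤n = ∈-bar⁺ (on 2≤n 2≤n) , equal-arms-P 1≤n (bar-bite22-ell 1≤n 1≤n)
  where 1≤n = <⇒≤ 2≤n

-- Diagonal openings of a square bar

11-loses : ∀ {a b} → ¬ WinningOpening a b (1 , 1)
11-loses {a} {b} (_ , P) = N⇒¬P (poison-bite-N (bar a b)) P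

-- The bite at (3 + k , 3 + k) leaves (2 , 2) and the first row and column, so
-- the reply (2 , 2) is available and leaves the ell with equal arms.
later-diagonal-loses : ∀ {n} → 2 ≤ n → ∀ k → ¬ WinningOpening n n (3 + k , 3 + k)
later-diagonal-loses {n} 2≤n k (_ , P) = N⇒¬P (move (2 , 2) 22∈ (equal-arms-P 1≤n ell)) P
  where
  1≤n = <⇒≤ 2≤n
  bitten = bite (3 + k , 3 + k) (bar n n)
  22∈ : (2 , 2) ∈ bitten
  22∈ = ∈-bite⁺ (∈-bar⁺ (on 2≤n 2≤n)) (λ { (s≤s (s≤s ()) , _) })
  ell⊆bitten : ∀ {y} → Ell n n y → y ∈ bitten
  ell⊆bitten l@(down _)   = ∈-bite⁺ (ell⊆bar 1≤n 1≤n l) (λ { (_ , s≤s ()) })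
  ell⊆bitten l@(across _) = ∈-bite⁺ (ell⊆bar 1≤n 1≤n l) (λ { (s≤s () , _) })
  ell : IsEll n n (bite (2 , 2) bitten)
  ell = bite22-ell (∈-bar⁻ ∘ proj₁ ∘ ∈-bite⁻ {p = bar n n}) ell⊆bitten

one-diagonal-winner : ∀ {n} → 2 ≤ n →
  length (filter (λ i → WinningOpening? n n (i , i)) (map suc (upTo n))) ≡ 1
one-diagonal-winner {suc (suc m)} 2≤n@(s≤s (s≤s _)) = cong length (begin
  filter W? (1 ∷ 2 ∷ rest)  ≡⟨ filter-reject W? {xs = 2 ∷ rest} (11-loses {n} {n}) ⟩
  filter W? (2 ∷ rest)      ≡⟨ filter-accept W? {xs = rest} (22-wins-square 2≤n) ⟩
  2 ∷ filter W? rest        ≡⟨ cong (λ zs → 2 ∷ filter W? zs) (map-applyUpTo (2 +_) suc m) ⟩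
  2 ∷ filter W? (applyUpTo (3 +_) m)
    ≡⟨ cong (2 ∷_) (filter-none W? (applyUpTo⁺₂ (3 +_) m (later-diagonal-loses 2≤n))) ⟩
  2 ∷ []                    ∎)
  where
  open ≡-Reasoning
  n = suc (suc m)
  W? : Decidable (λ i → WinningOpening n n (i , i))
  W? i = WinningOpening? n n (i , i)
  rest = map suc (applyUpTo (2 +_) m)

-- Counting a symmetric relation on a square

module _ {A : Set} {Q : Pred (A × A) 0ℓ} (Q? : Decidable Q) where

  count : List (A × A) → ℕ
  count xs = length (filter Q? xs)

  count-++ : ∀ xs ys → count (xs ++ ys) ≡ count xs + count ys
  count-++ xs ys = trans (cong length (filter-++ Q? xs ys)) (length-++ (filter Q? xs))

  count-column : ∀ xs y ys →
    count (cartesianProduct xs (y ∷ ys)) ≡ count (map (_, y) xs) + count (cartesianProduct xs ys)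
  count-column []       y ys = refl
  count-column (x ∷ xs) y ys = begin
    count ((x , y) ∷ [] ++ row ++ cartesianProduct xs (y ∷ ys))
      ≡⟨ count-++ ((x , y) ∷ []) _ ⟩
    i + count (row ++ cartesianProduct xs (y ∷ ys))
      ≡⟨ cong (i +_) (count-++ row _) ⟩
    i + (count row + count (cartesianProduct xs (y ∷ ys)))
      ≡⟨ cong (λ k → i + (count row + k)) (count-column xs y ys) ⟩
    i + (count row + (count col + count (cartesianProduct xs ys)))
      ≡⟨ exchange i (count row) (count col) _ ⟩
    (i + count col) + (count row + count (cartesianProduct xs ys))
      ≡⟨ cong₂ _+_ (count-++ ((x , y) ∷ []) col) (count-++ row _) ⟨
    count ((x , y) ∷ col) + count (row ++ cartesianProduct xs ys) ∎
    where
    open ≡-Reasoning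
    row = map (x ,_) ys
    col = map (_, y) xs
    i = count ((x , y) ∷ [])
    exchange : ∀ i r c p → i + (r + (c + p)) ≡ (i + c) + (r + p)
    exchange = solve-∀

  module _ (Q-swap : ∀ x → Q x → Q (swap x)) where

    count-swap : ∀ x ys → count (map (_, x) ys) ≡ count (map (x ,_) ys)
    count-swap x []       = refl
    count-swap x (y ∷ ys) with Q? (y , x) | Q? (x , y)
    ... | yes _ | yes _ = cong suc (count-swap x ys)
    ... | no  _ | no  _ = count-swap x ys
    ... | yes q | no ¬q = contradiction (Q-swap _ q) ¬q
    ... | no ¬q | yes q = contradiction (Q-swap _ q) ¬q

    -- Off the diagonal the elements pair up with their transposes.
    count-square : ∀ xs → ∃ λ k →
      count (cartesianProduct xs xs) ≡ length (filter (λ x → Q? (x , x)) xs) + k * 2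
    count-square []       = 0 , refl
    count-square (x ∷ xs) with count-square xs
    ... | k , eq = count row + k , (begin
      count ((x , x) ∷ [] ++ row ++ cartesianProduct xs (x ∷ xs))
        ≡⟨ count-++ ((x , x) ∷ []) _ ⟩
      i + count (row ++ cartesianProduct xs (x ∷ xs))
        ≡⟨ cong (i +_) (count-++ row _) ⟩
      i + (count row + count (cartesianProduct xs (x ∷ xs)))
        ≡⟨ cong (λ c → i + (count row + c)) (count-column xs x xs) ⟩
      i + (count row + (count (map (_, x) xs) + count (cartesianProduct xs xs)))
        ≡⟨ cong (λ c → i + (count row + c)) (cong₂ _+_ (count-swap x xs) eq) ⟩
      i + (count row + (count row + (diag xs + k * 2)))
        ≡⟨ collect i (count row) (diag xs) k ⟩
      (i + diag xs) + (count row + k) * 2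
        ≡⟨ cong (_+ (count row + k) * 2) diag-∷ ⟨
      diag (x ∷ xs) + (count row + k) * 2 ∎)
      where
      open ≡-Reasoning
      row = map (x ,_) xs
      i = count ((x , x) ∷ [])
      diag : List A → ℕ
      diag ys = length (filter (λ y → Q? (y , y)) ys)
      diag-∷ : diag (x ∷ xs) ≡ i + diag xs
      diag-∷ with Q? (x , x)
      ... | yes _ = refl
      ... | no  _ = refl
      collect : ∀ i r d k → i + (r + (r + (d + k * 2))) ≡ (i + d) + (r + k) * 2
      collect = solve-∀

#winningOpenings-odd : ∀ n → 2 ≤ n → #winningOpenings n n % 2 ≡ 1
#winningOpenings-odd n 2≤n
  with count-square (WinningOpening? n n) (winning-swap n n) (map suc (upTo n))
... | k , eq = begin
  #winningOpenings n n % 2  ≡⟨ cong (_% 2) eq ⟩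
  (length (filter (λ i → WinningOpening? n n (i , i)) (map suc (upTo n))) + k * 2) % 2
    ≡⟨ cong (λ d → (d + k * 2) % 2) (one-diagonal-winner 2≤n) ⟩
  (1 + k * 2) % 2           ≡⟨ [m+kn]%n≡m%n 1 k 2 ⟩
  1                         ∎
  where open ≡-Reasoning

-- The 1 × 1 bar has no winning opening, which holds by evaluation.
#winningOpenings≢2 : ∀ n → 1 ≤ n → #winningOpenings n n ≢ 2
#winningOpenings≢2 (suc zero)      _ ()
#winningOpenings≢2 n@(suc (suc _)) _ eq =
  case trans (cong (_% 2) (sym eq)) (#winningOpenings-odd n (s≤s (s≤s z≤n))) of λ ()

theorem4p4 : (∀ (a b : ℕ) → 1 ≤ a → 1 ≤ b → ¬ (a ≡ 1 × b ≡ 1) → (WinningOpening a b (2 , 2) ⇔ a ≡ b))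
    × (∀ (n : ℕ) → 2 ≤ n → #winningOpenings n n % 2 ≡ 1)
    × (∀ (n : ℕ) → 1 ≤ n → #winningOpenings n n ≢ 2)
theorem4p4 =
  (λ a b 1≤a 1≤b ¬11 → mk⇔ (22-wins⇒square 1≤a 1≤b) (square-wins 1≤a ¬11))
  , #winningOpenings-odd
  , #winningOpenings≢2
  where
  square-wins : ∀ {a b} → 1 ≤ a → ¬ (a ≡ 1 × b ≡ 1) → a ≡ b → WinningOpening a b (2 , 2)
  square-wins {suc zero}    _ ¬11 refl = contradiction (refl , refl) ¬11
  square-wins {suc (suc _)} _ _   refl = 22-wins-square (s≤s (s≤s z≤n))
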